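{- For every integer $k\ge 1$, $$\alpha_{2,2k}=k\,2^k.$$ Equivalently, the sequence $(\alpha_{2,2k})_{k\ge 1}$ coincides with the OEIS sequence A036289.
   Context: For integers $n,m\ge 1$, the grid $G(n,m)$ has cell set $V_{n,m}=\{(i,j): 1\le i\le n,\ 1\le j\le m\}$ ($i$ = row, $j$ = column). Contamination rules: a cell $u=(i,j)\in V_{n,m}$ can be contaminated by two contaminated cells $v,w\in V_{n,m}$ if one of the following holds: (a) $v=(i-1,j-1)$, $w=(i+1,j+1)$; (b) $v=(i+1,j-1)$, $w=(i-1,j+1)$; (c) $v=(i-1,j)$, $w=(i+1,j)$; (d) $v=(i,j-1)$, $w=(i,j+1)$; (e) $v=(i,j-1)$, $w=(i-1,j)$; (f) $v=(i,j-1)$, $w=(i+1,j)$; (g) $v=(i+1,j)$, $w=(i,j+1)$; (h) $v=(i-1,j)$, $w=(i,j+1)$. For $S\subseteq V_{n,m}$, the final contaminated set $C(S)$ is the smallest subset of $V_{n,m}$ containing $S$ and closed under rules (a)--(h). $S$ is a contaminating set if $C(S)=V_{n,m}$. The power contamination number $\gamma_c(G(n,m))$ is the minimum cardinality of a contaminating set; a contaminating set of this cardinality is an optimal solution. $\alpha_{n,m}$ denotes the number of optimal solutions of $G(n,m)$. The OEIS sequence A036289 is $k\mapsto k2^k$. -}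

module Defs where

open import Data.Fin.Base using (Fin; zero; suc; toℕ)
open import Data.Fin.Properties using (any?; all?) renaming (_≟_ to _≟ᶠ_)
open import Data.Fin.Subset as Sub using (Subset; inside; outside; ⁅_⁆; _∪_; ∁)
import Data.Fin.Subset.Properties as Subₚ
open import Data.List.Base as List using (List; []; _∷_; length; filter; cartesianProductWith)
open import Data.List.Extrema.Nat using (min)
open import Data.List.Membership.Propositional using () renaming (_∈_ to _∈ˡ_)
open import Data.List.Membership.Propositional.Properties using (∈-cartesianProductWith⁺)
import Data.List.Relation.Unary.All as All
import Data.List.Relation.Unary.AllPairs as AllPairs
open import Data.List.Relation.Unary.Any using (here; there)
open import Data.List.Relation.Unary.Unique.Propositional using (Unique)
open import Data.List.Relation.Unary.Unique.Propositional.Properties using (cartesianProductWith⁺)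
open import Data.Nat.Base using (ℕ; zero; suc; _*_; _<_)
open import Data.Nat.Induction using (<-wellFounded; Acc; acc)
open import Data.Nat.Properties using (+-monoˡ-<; +-monoʳ-<) renaming (_≟_ to _≟ⁿ_)
open import Data.Product using (_×_; _,_; ∃-syntax)
open import Data.Sum using (_⊎_; inj₁; inj₂)
open import Data.Vec.Base as Vec using (Vec; []; _∷_; lookup; _[_]%=_)
open import Data.Vec.Properties using (∷-injective)
open import Function.Base using (id)
open import Level using (0ℓ)
open import Relation.Binary.PropositionalEquality using (_≡_; refl)
open import Relation.Nullary using (Dec; yes; no; ¬_; ¬?; contradiction)
open import Relation.Nullary.Decidable using (map′; _×-dec_; _⊎-dec_)
open import Relation.Unary using (Pred; Decidable)

private
  variable
    n m : ℕ

-- The grid G(n,m), with rows and columns indexed from 0.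

Cell : ℕ → ℕ → Set
Cell n m = Fin n × Fin m

-- A set of cells is given row by row.

CellSet : ℕ → ℕ → Set
CellSet n m = Vec (Subset m) n

infix 4 _∈_ _∈?_ _⋖_ _⋖?_

_∈_ : Cell n m → CellSet n m → Set
(i , j) ∈ S = j Sub.∈ lookup S i

_∈?_ : (u : Cell n m) (S : CellSet n m) → Dec (u ∈ S)
(i , j) ∈? S = j Subₚ.∈? lookup S i

∣_∣ : CellSet n m → ℕ
∣ S ∣ = Vec.sum (Vec.map Sub.∣_∣ S)

_⋖_ : Fin n → Fin n → Set
i ⋖ j = suc (toℕ i) ≡ toℕ j

_⋖?_ : (i j : Fin n) → Dec (i ⋖ j)
i ⋖? j = suc (toℕ i) ≟ⁿ toℕ j

-- Rule u v w: the cell u can be contaminated by the cells v and w.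
-- Here i⁻ ⋖ i ⋖ i⁺ stand for the rows i - 1, i, i + 1, and likewise for
-- columns; since these are elements of Fin, all cells lie in the grid.

data Rule {n m : ℕ} : (u v w : Cell n m) → Set where
  rule-a : ∀ {i⁻ i i⁺ j⁻ j j⁺} → i⁻ ⋖ i → i ⋖ i⁺ → j⁻ ⋖ j → j ⋖ j⁺ →
           Rule (i , j) (i⁻ , j⁻) (i⁺ , j⁺)
  rule-b : ∀ {i⁻ i i⁺ j⁻ j j⁺} → i⁻ ⋖ i → i ⋖ i⁺ → j⁻ ⋖ j → j ⋖ j⁺ →
           Rule (i , j) (i⁺ , j⁻) (i⁻ , j⁺)
  rule-c : ∀ {i⁻ i i⁺ j} → i⁻ ⋖ i → i ⋖ i⁺ → Rule (i , j) (i⁻ , j) (i⁺ , j)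
  rule-d : ∀ {i j⁻ j j⁺} → j⁻ ⋖ j → j ⋖ j⁺ → Rule (i , j) (i , j⁻) (i , j⁺)
  rule-e : ∀ {i⁻ i j⁻ j} → i⁻ ⋖ i → j⁻ ⋖ j → Rule (i , j) (i , j⁻) (i⁻ , j)
  rule-f : ∀ {i i⁺ j⁻ j} → i ⋖ i⁺ → j⁻ ⋖ j → Rule (i , j) (i , j⁻) (i⁺ , j)
  rule-g : ∀ {i i⁺ j j⁺} → i ⋖ i⁺ → j ⋖ j⁺ → Rule (i , j) (i⁺ , j) (i , j⁺)
  rule-h : ∀ {i⁻ i j j⁺} → i⁻ ⋖ i → j ⋖ j⁺ → Rule (i , j) (i⁻ , j) (i , j⁺)

Closed : CellSet n m → Set
Closed T = ∀ {u v w} → Rule u v w → v ∈ T → w ∈ T → u ∈ T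

data C {n m : ℕ} (S : CellSet n m) : Pred (Cell n m) 0ℓ where
  seed   : ∀ {u} → u ∈ S → C S u
  spread : ∀ {u v w} → Rule u v w → C S v → C S w → C S u

C-least : {S : CellSet n m} (T : CellSet n m) →
          (∀ u → u ∈ S → u ∈ T) → Closed T → ∀ u → C S u → u ∈ T
C-least T S⊆T closed u (seed u∈S) = S⊆T u u∈S
C-least T S⊆T closed u (spread {v = v} {w} r p q) =
  closed r (C-least T S⊆T closed v p) (C-least T S⊆T closed w q)

Contaminating : Pred (CellSet n m) 0ℓ
Contaminating S = ∀ u → C S u

-- Decidability of C, needed to define γ-c and α as functions: cells are
-- added one at a time until the set is closed.

private
  Cases : (u v w : Cell n m) → Set
  Cases (i , j) (k , l) (k′ , l′) =
      (k ⋖ i × i ⋖ k′ × l ⋖ j × j ⋖ l′)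
    ⊎ (k′ ⋖ i × i ⋖ k × l ⋖ j × j ⋖ l′)
    ⊎ (k ⋖ i × i ⋖ k′ × l ≡ j × l′ ≡ j)
    ⊎ (k ≡ i × k′ ≡ i × l ⋖ j × j ⋖ l′)
    ⊎ (k ≡ i × k′ ⋖ i × l ⋖ j × l′ ≡ j)
    ⊎ (k ≡ i × i ⋖ k′ × l ⋖ j × l′ ≡ j)
    ⊎ (i ⋖ k × k′ ≡ i × l ≡ j × j ⋖ l′)
    ⊎ (k ⋖ i × k′ ≡ i × l ≡ j × j ⋖ l′)

  cases? : (u v w : Cell n m) → Dec (Cases u v w)
  cases? (i , j) (k , l) (k′ , l′) =
      (k ⋖? i ×-dec i ⋖? k′ ×-dec l ⋖? j ×-dec j ⋖? l′)
    ⊎-dec (k′ ⋖? i ×-dec i ⋖? k ×-dec l ⋖? j ×-dec j ⋖? l′)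
    ⊎-dec (k ⋖? i ×-dec i ⋖? k′ ×-dec l ≟ᶠ j ×-dec l′ ≟ᶠ j)
    ⊎-dec (k ≟ᶠ i ×-dec k′ ≟ᶠ i ×-dec l ⋖? j ×-dec j ⋖? l′)
    ⊎-dec (k ≟ᶠ i ×-dec k′ ⋖? i ×-dec l ⋖? j ×-dec l′ ≟ᶠ j)
    ⊎-dec (k ≟ᶠ i ×-dec i ⋖? k′ ×-dec l ⋖? j ×-dec l′ ≟ᶠ j)
    ⊎-dec (i ⋖? k ×-dec k′ ≟ᶠ i ×-dec l ≟ᶠ j ×-dec j ⋖? l′)
    ⊎-dec (k ⋖? i ×-dec k′ ≟ᶠ i ×-dec l ≟ᶠ j ×-dec j ⋖? l′)

  fromCases : {u v w : Cell n m} → Cases u v w → Rule u v w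
  fromCases (inj₁ (p , q , r , s)) = rule-a p q r s
  fromCases (inj₂ (inj₁ (p , q , r , s))) = rule-b p q r s
  fromCases (inj₂ (inj₂ (inj₁ (p , q , refl , refl)))) = rule-c p q
  fromCases (inj₂ (inj₂ (inj₂ (inj₁ (refl , refl , r , s))))) = rule-d r s
  fromCases (inj₂ (inj₂ (inj₂ (inj₂ (inj₁ (refl , q , r , refl)))))) = rule-e q r
  fromCases (inj₂ (inj₂ (inj₂ (inj₂ (inj₂ (inj₁ (refl , q , r , refl))))))) = rule-f q r
  fromCases (inj₂ (inj₂ (inj₂ (inj₂ (inj₂ (inj₂ (inj₁ (p , refl , refl , s)))))))) = rule-g p s
  fromCases (inj₂ (inj₂ (inj₂ (inj₂ (inj₂ (inj₂ (inj₂ (p , refl , refl , s)))))))) = rule-h p s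

  toCases : {u v w : Cell n m} → Rule u v w → Cases u v w
  toCases (rule-a p q r s) = inj₁ (p , q , r , s)
  toCases (rule-b p q r s) = inj₂ (inj₁ (p , q , r , s))
  toCases (rule-c p q) = inj₂ (inj₂ (inj₁ (p , q , refl , refl)))
  toCases (rule-d r s) = inj₂ (inj₂ (inj₂ (inj₁ (refl , refl , r , s))))
  toCases (rule-e q r) = inj₂ (inj₂ (inj₂ (inj₂ (inj₁ (refl , q , r , refl)))))
  toCases (rule-f q r) = inj₂ (inj₂ (inj₂ (inj₂ (inj₂ (inj₁ (refl , q , r , refl))))))
  toCases (rule-g p s) = inj₂ (inj₂ (inj₂ (inj₂ (inj₂ (inj₂ (inj₁ (p , refl , refl , s)))))))
  toCases (rule-h p s) = inj₂ (inj₂ (inj₂ (inj₂ (inj₂ (inj₂ (inj₂ (p , refl , refl , s)))))))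

rule? : (u v w : Cell n m) → Dec (Rule u v w)
rule? u v w = map′ fromCases toCases (cases? u v w)

anyCell? : {P : Pred (Cell n m) 0ℓ} → Decidable P → Dec (∃[ u ] P u)
anyCell? P? = map′ (λ (i , j , p) → (i , j) , p) (λ ((i , j) , p) → i , j , p)
  (any? λ i → any? λ j → P? (i , j))

allCell? : {P : Pred (Cell n m) 0ℓ} → Decidable P → Dec (∀ u → P u)
allCell? P? = map′ (λ p (i , j) → p i j) (λ p i j → p (i , j))
  (all? λ i → all? λ j → P? (i , j))

add : Cell n m → CellSet n m → CellSet n m
add (i , j) S = S [ i ]%= (_∪ ⁅ j ⁆)

private
  ∈-add : (u : Cell n m) (S : CellSet n m) → u ∈ add u S
  ∈-add (zero , j) (R ∷ S)  = Subₚ.q⊆p∪q R ⁅ j ⁆ (Subₚ.x∈⁅x⁆ j)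
  ∈-add (suc i , j) (R ∷ S) = ∈-add (i , j) S

  ⊆-add : (u v : Cell n m) (S : CellSet n m) → v ∈ S → v ∈ add u S
  ⊆-add (zero , j)  (zero , l)  (R ∷ S) = Subₚ.p⊆p∪q ⁅ j ⁆
  ⊆-add (zero , j)  (suc k , l) (R ∷ S) v∈S = v∈S
  ⊆-add (suc i , j) (zero , l)  (R ∷ S) v∈S = v∈S
  ⊆-add (suc i , j) (suc k , l) (R ∷ S) = ⊆-add (i , j) (k , l) S

  add-⊆ : (u v : Cell n m) (S : CellSet n m) → v ∈ add u S → v ∈ S ⊎ v ≡ u
  add-⊆ (zero , j) (zero , l) (R ∷ S) v∈ with Subₚ.x∈p∪q⁻ R ⁅ j ⁆ v∈
  ... | inj₁ l∈R = inj₁ l∈R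
  ... | inj₂ l∈j with Subₚ.x∈⁅y⁆⇒x≡y j l∈j
  ...   | refl = inj₂ refl
  add-⊆ (zero , j)  (suc k , l) (R ∷ S) v∈ = inj₁ v∈
  add-⊆ (suc i , j) (zero , l)  (R ∷ S) v∈ = inj₁ v∈
  add-⊆ (suc i , j) (suc k , l) (R ∷ S) v∈ with add-⊆ (i , j) (k , l) S v∈
  ... | inj₁ v∈S  = inj₁ v∈S
  ... | inj₂ refl = inj₂ refl

  missing : CellSet n m → ℕ
  missing S = Vec.sum (Vec.map (λ R → Sub.∣ ∁ R ∣) S)

  missing-add : (u : Cell n m) (S : CellSet n m) → ¬ u ∈ S → missing (add u S) < missing S
  missing-add (zero , j) (R ∷ S) j∉R = +-monoˡ-< (missing S)
    (Subₚ.p⊂q⇒∣p∣<∣q∣ (Subₚ.p⊂q⇒∁p⊃∁q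
      (Subₚ.p⊆p∪q ⁅ j ⁆ , j , Subₚ.q⊆p∪q R ⁅ j ⁆ (Subₚ.x∈⁅x⁆ j) , j∉R)))
  missing-add (suc i , j) (R ∷ S) u∉S =
    +-monoʳ-< Sub.∣ ∁ R ∣ (missing-add (i , j) S u∉S)

  violation? : (T : CellSet n m) →
               Dec (∃[ u ] ∃[ v ] ∃[ w ] (¬ u ∈ T × v ∈ T × w ∈ T × Rule u v w))
  violation? T = anyCell? λ u → anyCell? λ v → anyCell? λ w →
    ¬? (u ∈? T) ×-dec v ∈? T ×-dec w ∈? T ×-dec rule? u v w

  closure : (S T : CellSet n m) → (∀ u → u ∈ S → u ∈ T) → (∀ u → u ∈ T → C S u) →
            Acc _<_ (missing T) → Decidable (C S)
  closure S T S⊆T T⊆C (acc rec) with violation? T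
  ... | yes (u , v , w , u∉T , v∈T , w∈T , r) =
    closure S (add u T) (λ x x∈S → ⊆-add u x T (S⊆T x x∈S)) add⊆C (rec (missing-add u T u∉T))
    where
    add⊆C : ∀ x → x ∈ add u T → C S x
    add⊆C x x∈ with add-⊆ u x T x∈
    ... | inj₁ x∈T  = T⊆C x x∈T
    ... | inj₂ refl = spread r (T⊆C v v∈T) (T⊆C w w∈T)
  ... | no none = λ u → map′ (T⊆C u) (C-least T S⊆T closed u) (u ∈? T)
    where
    closed : Closed T
    closed {u} {v} {w} r v∈T w∈T with u ∈? T
    ... | yes u∈T = u∈T
    ... | no u∉T  = contradiction (u , v , w , u∉T , v∈T , w∈T , r) none

C? : (S : CellSet n m) → Decidable (C S)
C? S = closure S S (λ _ → id) (λ _ → seed) (<-wellFounded (missing S))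

contaminating? : Decidable (Contaminating {n} {m})
contaminating? S = allCell? (C? S)

vectors : {A : Set} → List A → ∀ n → List (Vec A n)
vectors xs zero    = [] ∷ []
vectors xs (suc n) = cartesianProductWith _∷_ xs (vectors xs n)

-- The list of all subsets of V_{n,m}, each occurring once.

cellSets : ∀ n m → List (CellSet n m)
cellSets n m = vectors (vectors (outside ∷ inside ∷ []) m) n

∈-vectors : {A : Set} {xs : List A} → (∀ x → x ∈ˡ xs) → ∀ {n} (v : Vec A n) → v ∈ˡ vectors xs n
∈-vectors complete []      = here refl
∈-vectors complete (x ∷ v) = ∈-cartesianProductWith⁺ _∷_ (complete x) (∈-vectors complete v)

∈-cellSets : (S : CellSet n m) → S ∈ˡ cellSets n m
∈-cellSets = ∈-vectors (∈-vectors λ { outside → here refl ; inside → there (here refl) })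

vectors-unique : {A : Set} {xs : List A} → Unique xs → ∀ n → Unique (vectors xs n)
vectors-unique unique zero    = All.[] AllPairs.∷ AllPairs.[]
vectors-unique unique (suc n) = cartesianProductWith⁺ _∷_ ∷-injective unique (vectors-unique unique n)

cellSets-unique : ∀ n m → Unique (cellSets n m)
cellSets-unique n m = vectors-unique (vectors-unique
  (((λ ()) All.∷ All.[]) AllPairs.∷ All.[] AllPairs.∷ AllPairs.[]) m) n

-- The first argument of min is harmless: V_{n,m} is itself a contaminating
-- set, of cardinality n * m.

γ-c : ℕ → ℕ → ℕ
γ-c n m = min (n * m) (List.map ∣_∣ (filter contaminating? (cellSets n m)))

Optimal : Pred (CellSet n m) 0ℓ
Optimal {n} {m} S = Contaminating S × ∣ S ∣ ≡ γ-c n m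

optimal? : Decidable (Optimal {n} {m})
optimal? {n} {m} S = contaminating? S ×-dec ∣ S ∣ ≟ⁿ γ-c n m

α : ℕ → ℕ → ℕ
α n m = length (filter optimal? (cellSets n m))

-- In a contaminating set S of the 2 × 2k grid the last column and one of any two
-- adjacent columns are nonempty, and so is the first column; hence S has at least
-- k + 1 cells.  Moreover some two cells of S in different rows lie in the same column
-- or in adjacent ones: otherwise only rule (d) ever applies, and applying it once to S
-- already gives a closed set.  With exactly k + 1 cells this leaves the words of
-- singleton columns separated by single empty columns, except at one place, where two
-- singletons in different rows are adjacent; conversely such a word spreads outwards
-- from this place.  The place can be chosen in k ways, and then the rows in 2 ^ k ways.

module Submission where

open import Defs
open import Data.Empty using (⊥-elim)
open import Data.Fin using (Fin; zero; suc; toℕ; opposite; _↑ʳ_)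
open import Data.Fin.Properties using (any?; toℕ-injective; toℕ<n) renaming (_≟_ to _≟ᶠ_)
open import Data.Fin.Subset as Sub using (Subset; inside; outside; ⁅_⁆; ⊤; ⊥; Nonempty)
import Data.Fin.Subset.Properties as Subₚ
open import Data.List using (List; []; _∷_; _++_; length; map; filter; allFin; cartesianProductWith)
open import Data.List.Extrema.Nat using (min≤v⁺; v≤min⁺)
open import Data.List.Membership.Propositional using (lose) renaming (_∈_ to _∈ˡ_)
open import Data.List.Membership.Propositional.Properties
  using (∈-cartesianProductWith⁺; ∈-cartesianProductWith⁻; ∈-++⁺ˡ; ∈-++⁺ʳ; ∈-++⁻;
         ∈-filter⁺; ∈-filter⁻; ∈-map⁺; ∈-map⁻; ∈-allFin)
open import Data.List.Membership.Propositional.Properties.WithK using (unique∧set⇒bag)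
open import Data.List.Properties using (length-map; length-++)
open import Data.List.Relation.Binary.BagAndSetEquality using (∼bag⇒↭)
open import Data.List.Relation.Binary.Permutation.Propositional.Properties using (↭-length)
import Data.List.Relation.Unary.All as All
import Data.List.Relation.Unary.AllPairs as AllPairs
open import Data.List.Relation.Unary.Any using (here)
open import Data.List.Relation.Unary.Unique.Propositional using (Unique)
open import Data.List.Relation.Unary.Unique.Propositional.Properties
  using (cartesianProductWith⁺; ++⁺; allFin⁺; filter⁺)
open import Data.Nat using (ℕ; zero; suc; _+_; _*_; _^_; _≤_; _<_; z≤n; s≤s)
open import Data.Nat.Properties
open import Data.Nat.Tactic.RingSolver using (solve-∀)
open import Data.Product using (_×_; _,_; proj₁; proj₂; ∃-syntax; ∃₂)
open import Data.Sum using (_⊎_; inj₁; inj₂; [_,_]′)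
open import Data.Vec using ([]; _∷_; here; there)
open import Function using (_∘_; mk⇔)
open import Level using (0ℓ)
open import Relation.Binary.PropositionalEquality
  using (_≡_; _≢_; refl; sym; trans; cong; cong₂; subst; module ≡-Reasoning)
open import Relation.Nullary using (Dec; yes; no; ¬_; contradiction)
open import Relation.Unary using (Pred; Decidable)

private
  variable
    k m m′ : ℕ

-- An excess in one summand could not be made up by the other. This turns an exact number of cells
-- in a word into exact numbers for its first columns and for the rest.
+-tight : ∀ {a b x y} → a ≤ x → b ≤ y → x + y ≡ a + b → x ≡ a × y ≡ b
+-tight {a} {b} {x} {y} a≤x b≤y eq =
  ≤-antisym (+-cancelʳ-≤ b x a (≤-trans (+-monoʳ-≤ x b≤y) (≤-reflexive eq))) a≤x ,
  ≤-antisym (+-cancelˡ-≤ a y b (≤-trans (+-monoˡ-≤ y a≤x) (≤-reflexive eq))) b≤y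

length-cartesianProductWith : {A B D : Set} (f : A → B → D) (xs : List A) (ys : List B) →
                              length (cartesianProductWith f xs ys) ≡ length xs * length ys
length-cartesianProductWith f []       ys = refl
length-cartesianProductWith f (x ∷ xs) ys = trans (length-++ (map (f x) ys))
  (cong₂ _+_ (length-map (f x) ys) (length-cartesianProductWith f xs ys))

-- Neighbouring indices and the two rows

⋖-uniqueˡ : {i i′ j : Fin m} → i ⋖ j → i′ ⋖ j → i ≡ i′
⋖-uniqueˡ p q = toℕ-injective (suc-injective (trans p (sym q)))

⋖-uniqueʳ : {i j j′ : Fin m} → i ⋖ j → i ⋖ j′ → j ≡ j′
⋖-uniqueʳ p q = toℕ-injective (trans (sym p) q)

⋖-irrefl : {i : Fin m} → ¬ i ⋖ i
⋖-irrefl = 1+n≢n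

-- Rules (a), (b) and (c) need a row on either side, so they never apply in a grid with two rows.
no-middle : {i⁻ i i⁺ : Fin 2} → i⁻ ⋖ i → ¬ i ⋖ i⁺
no-middle {i = zero} ()
no-middle {i = suc zero} {zero} _ ()
no-middle {i = suc zero} {suc zero} _ ()

≢-opposite : (r : Fin 2) → r ≢ opposite r
≢-opposite zero       ()
≢-opposite (suc zero) ()

≢⇒opposite : {r s : Fin 2} → r ≢ s → s ≡ opposite r
≢⇒opposite {zero}     {zero}     r≢s = contradiction refl r≢s
≢⇒opposite {zero}     {suc zero} r≢s = refl
≢⇒opposite {suc zero} {zero}     r≢s = refl
≢⇒opposite {suc zero} {suc zero} r≢s = contradiction refl r≢s

both-rows : {P : Pred (Fin 2) 0ℓ} (r : Fin 2) → P r → P (opposite r) → ∀ s → P s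
both-rows zero       p q zero       = p
both-rows zero       p q (suc zero) = q
both-rows (suc zero) p q zero       = q
both-rows (suc zero) p q (suc zero) = p

nonempty⇒∣∣≥1 : (c : Subset 2) → Nonempty c → 1 ≤ Sub.∣ c ∣
nonempty⇒∣∣≥1 c (r , r∈c) = subst (_≤ Sub.∣ c ∣) (Subₚ.∣⁅x⁆∣≡1 r)
  (Subₚ.p⊆q⇒∣p∣≤∣q∣ λ x∈ → subst (Sub._∈ c) (sym (Subₚ.x∈⁅y⁆⇒x≡y r x∈)) r∈c)

∣∣≡1⇒singleton : (c : Subset 2) → Sub.∣ c ∣ ≡ 1 → ∃[ r ] c ≡ ⁅ r ⁆
∣∣≡1⇒singleton (inside  ∷ outside ∷ []) _ = zero , refl
∣∣≡1⇒singleton (outside ∷ inside  ∷ []) _ = suc zero , refl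

-- Words of columns

infixr 5 _◁_

_◁_ : Subset 2 → CellSet 2 m → CellSet 2 (suc m)
(x ∷ y ∷ []) ◁ (a ∷ b ∷ []) = (x ∷ a) ∷ (y ∷ b) ∷ []

uncons : (S : CellSet 2 (suc m)) → ∃₂ λ c S′ → S ≡ c ◁ S′
uncons ((x ∷ a) ∷ (y ∷ b) ∷ []) = x ∷ y ∷ [] , a ∷ b ∷ [] , refl

◁-injective : (c d : Subset 2) (S T : CellSet 2 m) → c ◁ S ≡ d ◁ T → c ≡ d × S ≡ T
◁-injective (_ ∷ _ ∷ []) (_ ∷ _ ∷ []) (_ ∷ _ ∷ []) (_ ∷ _ ∷ []) refl = refl , refl

∣◁∣ : (c : Subset 2) (S : CellSet 2 m) → ∣ c ◁ S ∣ ≡ Sub.∣ c ∣ + ∣ S ∣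
∣◁∣ (outside ∷ outside ∷ []) (a ∷ b ∷ []) = refl
∣◁∣ (inside  ∷ outside ∷ []) (a ∷ b ∷ []) = refl
∣◁∣ (outside ∷ inside  ∷ []) (a ∷ b ∷ []) = +-suc Sub.∣ a ∣ (Sub.∣ b ∣ + 0)
∣◁∣ (inside  ∷ inside  ∷ []) (a ∷ b ∷ []) = cong suc (+-suc Sub.∣ a ∣ (Sub.∣ b ∣ + 0))

∣◁◁∣ : (c d : Subset 2) (S : CellSet 2 m) → ∣ c ◁ d ◁ S ∣ ≡ Sub.∣ c ∣ + (Sub.∣ d ∣ + ∣ S ∣)
∣◁◁∣ c d S = trans (∣◁∣ c (d ◁ S)) (cong (Sub.∣ c ∣ +_) (∣◁∣ d S))

head⁺ : (c : Subset 2) (S : CellSet 2 m) {r : Fin 2} → r Sub.∈ c → (r , zero) ∈ c ◁ S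
head⁺ (_ ∷ _ ∷ []) (_ ∷ _ ∷ []) here = here
head⁺ (_ ∷ _ ∷ []) (_ ∷ _ ∷ []) (there here) = here

head⁻ : (c : Subset 2) (S : CellSet 2 m) {r : Fin 2} → (r , zero) ∈ c ◁ S → r Sub.∈ c
head⁻ (_ ∷ _ ∷ []) (_ ∷ _ ∷ []) {zero}     here = here
head⁻ (_ ∷ _ ∷ []) (_ ∷ _ ∷ []) {suc zero} here = there here

tail⁺ : (c : Subset 2) (S : CellSet 2 m) {r : Fin 2} {j : Fin m} → (r , j) ∈ S → (r , suc j) ∈ c ◁ S
tail⁺ (_ ∷ _ ∷ []) (_ ∷ _ ∷ []) {zero}     = there
tail⁺ (_ ∷ _ ∷ []) (_ ∷ _ ∷ []) {suc zero} = there

tail⁻ : (c : Subset 2) (S : CellSet 2 m) {r : Fin 2} {j : Fin m} → (r , suc j) ∈ c ◁ S → (r , j) ∈ S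
tail⁻ (_ ∷ _ ∷ []) (_ ∷ _ ∷ []) {zero}     (there p) = p
tail⁻ (_ ∷ _ ∷ []) (_ ∷ _ ∷ []) {suc zero} (there p) = p

-- The optimal words are cut into blocks of two columns: some `single-blank` blocks, then one
-- `diagonal` block, then some `blank-single` blocks.
blank-single single-blank diagonal : Fin 2 → CellSet 2 m → CellSet 2 (suc (suc m))
blank-single r S = ⊥ ◁ ⁅ r ⁆ ◁ S
single-blank r S = ⁅ r ⁆ ◁ ⊥ ◁ S
diagonal r S = ⁅ r ⁆ ◁ ⁅ opposite r ⁆ ◁ S

-- The width is written `k * 2` because `suc k * 2` computes to two columns followed by `k * 2`
-- more, which is one block.
alternating : ∀ k → List (CellSet 2 (k * 2))
alternating zero    = ([] ∷ [] ∷ []) ∷ []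
alternating (suc k) = cartesianProductWith blank-single (allFin 2) (alternating k)

optima : ∀ k → List (CellSet 2 (k * 2))
optima zero    = []
optima (suc k) =
  cartesianProductWith single-blank (allFin 2) (optima k) ++
  cartesianProductWith diagonal (allFin 2) (alternating k)

-- A view of membership in `optima`: matching on it exposes the first block and the shape of the set
-- at once.
data Optimum : ∀ k → CellSet 2 (k * 2) → Set where
  skip : (r : Fin 2) {S : CellSet 2 (k * 2)} → S ∈ˡ optima k → Optimum (suc k) (⁅ r ⁆ ◁ ⊥ ◁ S)
  pair : (r : Fin 2) {S : CellSet 2 (k * 2)} → S ∈ˡ alternating k →
         Optimum (suc k) (⁅ r ⁆ ◁ ⁅ opposite r ⁆ ◁ S)

∈-alternating⁺ : ∀ k (r : Fin 2) {S : CellSet 2 (k * 2)} → S ∈ˡ alternating k →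
                 ⊥ ◁ ⁅ r ⁆ ◁ S ∈ˡ alternating (suc k)
∈-alternating⁺ k r S∈ = ∈-cartesianProductWith⁺ blank-single (∈-allFin r) S∈

∈-alternating⁻ : ∀ k {S : CellSet 2 (suc k * 2)} → S ∈ˡ alternating (suc k) →
                 ∃₂ λ r S′ → S′ ∈ˡ alternating k × S ≡ ⊥ ◁ ⁅ r ⁆ ◁ S′
∈-alternating⁻ k S∈ with ∈-cartesianProductWith⁻ blank-single (allFin 2) (alternating k) S∈
... | r , S′ , _ , S′∈ , eq = r , S′ , S′∈ , eq

∈-optima⁺ : ∀ {k S} → Optimum k S → S ∈ˡ optima k
∈-optima⁺ (skip r S∈)     = ∈-++⁺ˡ (∈-cartesianProductWith⁺ single-blank (∈-allFin r) S∈)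
∈-optima⁺ (pair {k} r S∈) = ∈-++⁺ʳ
  (cartesianProductWith single-blank (allFin 2) (optima k))
  (∈-cartesianProductWith⁺ diagonal (∈-allFin r) S∈)

∈-optima⁻ : ∀ k {S} → S ∈ˡ optima k → Optimum k S
∈-optima⁻ (suc k) S∈ with ∈-++⁻ (cartesianProductWith single-blank (allFin 2) (optima k)) S∈
... | inj₁ p with ∈-cartesianProductWith⁻ single-blank (allFin 2) (optima k) p
...   | r , S′ , _ , S′∈ , refl = skip r S′∈
∈-optima⁻ (suc k) S∈ | inj₂ p with ∈-cartesianProductWith⁻ diagonal (allFin 2) (alternating k) p
...   | r , S′ , _ , S′∈ , refl = pair r S′∈

⁅⁆-injective : {r s : Fin 2} → ⁅ r ⁆ ≡ ⁅ s ⁆ → r ≡ s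
⁅⁆-injective {r} eq = Subₚ.x∈⁅y⁆⇒x≡y _ (subst (r Sub.∈_) eq (Subₚ.x∈⁅x⁆ r))

⊥≢⁅⁆ : {r : Fin 2} → ⊥ ≢ ⁅ r ⁆
⊥≢⁅⁆ {r} eq = Subₚ.∉⊥ (subst (r Sub.∈_) (sym eq) (Subₚ.x∈⁅x⁆ r))

alternating-unique : ∀ k → Unique (alternating k)
alternating-unique zero    = All.[] AllPairs.∷ AllPairs.[]
alternating-unique (suc k) = cartesianProductWith⁺ blank-single
  (λ {r} {s} {S} {T} eq → let _ , eq′ = ◁-injective ⊥ ⊥ (⁅ r ⁆ ◁ S) (⁅ s ⁆ ◁ T) eq
                              p , q   = ◁-injective ⁅ r ⁆ ⁅ s ⁆ S T eq′
                          in ⁅⁆-injective p , q)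
  (allFin⁺ 2) (alternating-unique k)

optima-unique : ∀ k → Unique (optima k)
optima-unique zero    = AllPairs.[]
optima-unique (suc k) = ++⁺
  (cartesianProductWith⁺ single-blank (λ {r} {s} {S} {T} eq →
     let p , eq′ = ◁-injective ⁅ r ⁆ ⁅ s ⁆ (⊥ ◁ S) (⊥ ◁ T) eq
     in ⁅⁆-injective p , proj₂ (◁-injective ⊥ ⊥ S T eq′)) (allFin⁺ 2) (optima-unique k))
  (cartesianProductWith⁺ diagonal (λ {r} {s} {S} {T} eq →
     let p , eq′ = ◁-injective ⁅ r ⁆ ⁅ s ⁆ (⁅ opposite r ⁆ ◁ S) (⁅ opposite s ⁆ ◁ T) eq
     in ⁅⁆-injective p , proj₂ (◁-injective ⁅ opposite r ⁆ ⁅ opposite s ⁆ S T eq′))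
     (allFin⁺ 2) (alternating-unique k))
  disjoint
  where
  -- The second column is blank in the first list and a singleton in the second.
  disjoint : ∀ {S} → ¬ (S ∈ˡ _ × S ∈ˡ _)
  disjoint (p , q)
    with ∈-cartesianProductWith⁻ single-blank (allFin 2) (optima k) p
       | ∈-cartesianProductWith⁻ diagonal (allFin 2) (alternating k) q
  ... | r , S , _ , _ , refl | s , T , _ , _ , eq =
    ⊥≢⁅⁆ (proj₁ (◁-injective ⊥ ⁅ opposite s ⁆ S T
      (proj₂ (◁-injective ⁅ r ⁆ ⁅ s ⁆ (⊥ ◁ S) (⁅ opposite s ⁆ ◁ T) eq))))

length-alternating : ∀ k → length (alternating k) ≡ 2 ^ k
length-alternating zero    = refl
length-alternating (suc k) =
  trans (length-cartesianProductWith blank-single (allFin 2) (alternating k)) (cong (2 *_) (length-alternating k))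

length-optima : ∀ k → length (optima k) ≡ k * 2 ^ k
length-optima zero    = refl
length-optima (suc k) = begin
  length (optima (suc k))
    ≡⟨ length-++ (cartesianProductWith single-blank (allFin 2) (optima k)) ⟩
  _ ≡⟨ cong₂ _+_ (length-cartesianProductWith single-blank (allFin 2) (optima k))
                 (length-cartesianProductWith diagonal (allFin 2) (alternating k)) ⟩
  2 * length (optima k) + 2 * length (alternating k)
    ≡⟨ cong₂ (λ x y → 2 * x + 2 * y) (length-optima k) (length-alternating k) ⟩
  2 * (k * 2 ^ k) + 2 * 2 ^ k
    ≡⟨ arith k (2 ^ k) ⟩
  suc k * 2 ^ suc k ∎
  where
  open ≡-Reasoning
  arith : ∀ k p → 2 * (k * p) + 2 * p ≡ suc k * (2 * p)
  arith = solve-∀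

∣alternating∣ : ∀ k {S} → S ∈ˡ alternating k → ∣ S ∣ ≡ k
∣alternating∣ zero    (here refl) = refl
∣alternating∣ (suc k) S∈ with ∈-alternating⁻ k S∈
... | r , S′ , S′∈ , refl = trans (∣◁◁∣ ⊥ ⁅ r ⁆ S′)
  (cong₂ _+_ (Subₚ.∣⁅x⁆∣≡1 r) (∣alternating∣ k S′∈))

∣optima∣ : ∀ k {S} → S ∈ˡ optima k → ∣ S ∣ ≡ suc k
∣optima∣ (suc k) S∈ with ∈-optima⁻ (suc k) S∈
... | skip r {S} S∈′ = trans (∣◁◁∣ ⁅ r ⁆ ⊥ S) (cong₂ _+_ (Subₚ.∣⁅x⁆∣≡1 r) (∣optima∣ k S∈′))
... | pair r {S} S∈′ = trans (∣◁◁∣ ⁅ r ⁆ ⁅ opposite r ⁆ S)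
  (cong₂ _+_ (Subₚ.∣⁅x⁆∣≡1 r) (cong₂ _+_ (Subₚ.∣⁅x⁆∣≡1 (opposite r)) (∣alternating∣ k S∈′)))

-- Spreading of the listed sets

-- Rules (e) and (f) merged, so that the row need not be fixed: a cell follows from its left
-- neighbour and the other cell of its column. `spread-left` does the same for (g) and (h).
spread-right : {S : CellSet 2 m} {r s : Fin 2} {j⁻ j : Fin m} → j⁻ ⋖ j → r ≢ s →
               C S (r , j⁻) → C S (s , j) → C S (r , j)
spread-right {r = zero}     {zero}     p r≢s = contradiction refl r≢s
spread-right {r = zero}     {suc zero} p r≢s = spread (rule-f refl p)
spread-right {r = suc zero} {zero}     p r≢s = spread (rule-e refl p)
spread-right {r = suc zero} {suc zero} p r≢s = contradiction refl r≢s

spread-left : {S : CellSet 2 m} {r s : Fin 2} {j j⁺ : Fin m} → j ⋖ j⁺ → r ≢ s →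
              C S (s , j) → C S (r , j⁺) → C S (r , j)
spread-left {r = zero}     {zero}     p r≢s = contradiction refl r≢s
spread-left {r = zero}     {suc zero} p r≢s = spread (rule-g refl p)
spread-left {r = suc zero} {zero}     p r≢s = spread (rule-h refl p)
spread-left {r = suc zero} {suc zero} p r≢s = contradiction refl r≢s

module _ (f : Fin m → Fin m′) (mono : ∀ {i j} → i ⋖ j → f i ⋖ f j) where

  moved : Cell 2 m → Cell 2 m′
  moved (r , j) = r , f j

  Rule-moved : ∀ {u v w} → Rule u v w → Rule (moved u) (moved v) (moved w)
  Rule-moved (rule-a p q r s) = rule-a p q (mono r) (mono s)
  Rule-moved (rule-b p q r s) = rule-b p q (mono r) (mono s)
  Rule-moved (rule-c p q)     = rule-c p q
  Rule-moved (rule-d r s)     = rule-d (mono r) (mono s)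
  Rule-moved (rule-e p r)     = rule-e p (mono r)
  Rule-moved (rule-f p r)     = rule-f p (mono r)
  Rule-moved (rule-g p r)     = rule-g p (mono r)
  Rule-moved (rule-h p r)     = rule-h p (mono r)

  -- The cells of `S` need only become contaminated in `T`, not belong to it. A column filled along
  -- the way can therefore serve as a full first column of a shorter grid, to which induction
  -- applies.
  C-moved : {S : CellSet 2 m} {T : CellSet 2 m′} →
            (∀ u → u ∈ S → C T (moved u)) → ∀ {u} → C S u → C T (moved u)
  C-moved S⊆T (seed u∈S)     = S⊆T _ u∈S
  C-moved S⊆T (spread r p q) = spread (Rule-moved r) (C-moved S⊆T p) (C-moved S⊆T q)

-- The full column advances by one block: rule (d) bridges the blank column in the row `s` of the
-- next singleton, and corner rules then fill the other row of both columns.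
contaminating-⊤◁ : ∀ k {S} → S ∈ˡ alternating k → Contaminating (⊤ ◁ S)
contaminating-⊤◁ k {S} S∈ (r , zero) = seed (head⁺ ⊤ S Subₚ.∈⊤)
contaminating-⊤◁ (suc k) S∈ (r , suc j) with ∈-alternating⁻ k S∈
... | s , S , S∈′ , refl = cell j
  where
  S₂ = ⁅ s ⁆ ◁ S
  S₁ = ⊥ ◁ S₂
  T = ⊤ ◁ S₁
  t = opposite s

  full₀ : ∀ r → C T (r , zero)
  full₀ r = seed (head⁺ ⊤ S₁ Subₚ.∈⊤)

  s₂ : C T (s , suc (suc zero))
  s₂ = seed (tail⁺ ⊤ S₁ (tail⁺ ⊥ S₂ (head⁺ ⁅ s ⁆ S (Subₚ.x∈⁅x⁆ s))))

  s₁ : C T (s , suc zero)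
  s₁ = spread (rule-d refl refl) (full₀ s) s₂

  t₁ : C T (t , suc zero)
  t₁ = spread-right refl (≢-opposite s ∘ sym) (full₀ t) s₁

  t₂ : C T (t , suc (suc zero))
  t₂ = spread-right refl (≢-opposite s ∘ sym) t₁ s₂

  rest : ∀ u → u ∈ ⊤ ◁ S → C T (proj₁ u , suc (suc (proj₂ u)))
  rest (r , zero)  _  = both-rows s s₂ t₂ r
  rest (r , suc j) u∈ = seed (tail⁺ ⊤ S₁ (tail⁺ ⊥ S₂ (tail⁺ ⁅ s ⁆ S (tail⁻ ⊤ S u∈))))

  cell : ∀ j → C T (r , suc j)
  cell zero    = both-rows {P = λ r → C T (r , suc zero)} s s₁ t₁ r
  cell (suc j) = C-moved (2 ↑ʳ_) (cong (2 +_)) rest (contaminating-⊤◁ k S∈′ (r , j))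

-- Two diagonal cells fill their 2 × 2 square, whose second column then acts as the full column in
-- front of the alternating word.
contaminating-diagonal : ∀ k {S} → S ∈ˡ alternating k → (r : Fin 2) → Contaminating (diagonal r S)
contaminating-diagonal k {S} S∈ r = cell
  where
  T = diagonal r S
  t = opposite r

  r₀ : C T (r , zero)
  r₀ = seed (head⁺ ⁅ r ⁆ (⁅ t ⁆ ◁ S) (Subₚ.x∈⁅x⁆ r))

  t₁ : C T (t , suc zero)
  t₁ = seed (tail⁺ ⁅ r ⁆ (⁅ t ⁆ ◁ S) (head⁺ ⁅ t ⁆ S (Subₚ.x∈⁅x⁆ t)))

  t₀ : C T (t , zero)
  t₀ = spread-left refl (≢-opposite r ∘ sym) r₀ t₁

  r₁ : C T (r , suc zero)
  r₁ = spread-right refl (≢-opposite r) r₀ t₁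

  rest : ∀ u → u ∈ ⊤ ◁ S → C T (proj₁ u , suc (proj₂ u))
  rest (s , zero)  _  = both-rows r r₁ t₁ s
  rest (s , suc j) u∈ = seed (tail⁺ ⁅ r ⁆ (⁅ t ⁆ ◁ S) (tail⁺ ⁅ t ⁆ S (tail⁻ ⊤ S u∈)))

  cell : ∀ u → C T u
  cell (s , zero)  = both-rows r r₀ t₀ s
  cell (s , suc j) = C-moved (1 ↑ʳ_) (cong (1 +_)) rest (contaminating-⊤◁ k S∈ (s , j))

-- Spreading runs leftwards here: the first column of the suffix, which exists since the width is
-- `suc m`, becomes full; rule (d) bridges the blank in row `r`, and corner rules fill the other
-- row.
contaminating-single-blank : {S : CellSet 2 (suc m)} → Contaminating S → (r : Fin 2) →
                             Contaminating (single-blank r S)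
contaminating-single-blank {S = S} full r = cell
  where
  T = single-blank r S
  t = opposite r

  rest : ∀ u → C T (proj₁ u , suc (suc (proj₂ u)))
  rest u = C-moved (2 ↑ʳ_) (cong (2 +_)) (λ _ v∈ → seed (tail⁺ ⁅ r ⁆ (⊥ ◁ S) (tail⁺ ⊥ S v∈))) (full u)

  r₀ : C T (r , zero)
  r₀ = seed (head⁺ ⁅ r ⁆ (⊥ ◁ S) (Subₚ.x∈⁅x⁆ r))

  r₁ : C T (r , suc zero)
  r₁ = spread (rule-d refl refl) r₀ (rest (r , zero))

  t₁ : C T (t , suc zero)
  t₁ = spread-left refl (≢-opposite r ∘ sym) r₁ (rest (t , zero))

  t₀ : C T (t , zero)
  t₀ = spread-left refl (≢-opposite r ∘ sym) r₀ t₁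

  cell : ∀ u → C T u
  cell (s , zero)        = both-rows r r₀ t₀ s
  cell (s , suc zero)    = both-rows r r₁ t₁ s
  cell (s , suc (suc j)) = rest (s , j)

optima-contaminating : ∀ k {S} → S ∈ˡ optima k → Contaminating S
optima-contaminating (suc k) S∈ with ∈-optima⁻ (suc k) S∈
... | pair r S∈′ = contaminating-diagonal k S∈′ r
-- `optima zero` is empty, so a skipped block is always followed by another one.
optima-contaminating (suc (suc k)) S∈ | skip r S∈′ =
  contaminating-single-blank (optima-contaminating (suc k) S∈′) r

-- Necessary conditions

Hit : CellSet 2 m → Fin m → Set
Hit S j = ∃[ r ] (r , j) ∈ S

hit? : (S : CellSet 2 m) (j : Fin m) → Dec (Hit S j)
hit? S j = any? λ r → (r , j) ∈? S

rule-columns : ∀ {u v w : Cell 2 m} → Rule u v w →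
               proj₂ u ≡ proj₂ v ⊎ proj₂ u ≡ proj₂ w ⊎ (proj₂ v ⋖ proj₂ u × proj₂ u ⋖ proj₂ w)
rule-columns (rule-a _ _ r s) = inj₂ (inj₂ (r , s))
rule-columns (rule-b _ _ r s) = inj₂ (inj₂ (r , s))
rule-columns (rule-c _ _)     = inj₁ refl
rule-columns (rule-d r s)     = inj₂ (inj₂ (r , s))
rule-columns (rule-e _ _)     = inj₂ (inj₁ refl)
rule-columns (rule-f _ _)     = inj₂ (inj₁ refl)
rule-columns (rule-g _ _)     = inj₁ refl
rule-columns (rule-h _ _)     = inj₁ refl

-- By `rule-columns`, a column without contamination can only be entered from both neighbours at
-- once. In a set `D` of columns missed by `S`, this is blocked if each column is at the border of
-- the grid or has a neighbour in `D`. The choices of `D` below are the first column, the last one,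
-- and two adjacent ones.
C-avoids : {S : CellSet 2 m} (D : Pred (Fin m) 0ℓ) →
           (∀ {i j l} → i ⋖ j → j ⋖ l → D j → D i ⊎ D l) →
           (∀ {j} → Hit S j → ¬ D j) → ∀ {u} → C S u → ¬ D (proj₂ u)
C-avoids D thick avoid (seed u∈S) Du = avoid (_ , u∈S) Du
C-avoids D thick avoid (spread r p q) Du with rule-columns r
... | inj₁ refl        = C-avoids D thick avoid p Du
... | inj₂ (inj₁ refl) = C-avoids D thick avoid q Du
... | inj₂ (inj₂ (v⋖u , u⋖w)) with thick v⋖u u⋖w Du
...   | inj₁ Dv = C-avoids D thick avoid p Dv
...   | inj₂ Dw = C-avoids D thick avoid q Dw

-- These conditions pass to suffixes, hence suit induction. That the first column is hit does not,
-- and is carried separately.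
record Covering (S : CellSet 2 m) : Set where
  field
    adjacent : ∀ {i j} → i ⋖ j → Hit S i ⊎ Hit S j
    last     : ∀ {j} → suc (toℕ j) ≡ m → Hit S j

open Covering

contaminating⇒first : {S : CellSet 2 (suc m)} → Contaminating S → Hit S zero
contaminating⇒first {S = S} full with hit? S zero
... | yes h = h
... | no ¬h = contradiction refl
  (C-avoids (_≡ zero) (λ { () _ refl }) (λ { h refl → ¬h h }) (full (zero , zero)))

contaminating⇒covering : {S : CellSet 2 m} → Contaminating S → Covering S
contaminating⇒covering {m} {S} full = record { adjacent = adj ; last = end }
  where
  end : ∀ {j} → suc (toℕ j) ≡ m → Hit S j
  end {j} eq with hit? S j
  ... | yes h = h
  ... | no ¬h = contradiction refl
    (C-avoids (_≡ j) (λ { {l = l} _ j⋖l refl → contradiction (trans (sym j⋖l) eq) (<⇒≢ (toℕ<n l)) })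
      (λ { h refl → ¬h h }) (full (zero , j)))

  adj : ∀ {i j} → i ⋖ j → Hit S i ⊎ Hit S j
  adj {i} {j} i⋖j with hit? S i | hit? S j
  ... | yes h | _     = inj₁ h
  ... | no _  | yes h = inj₂ h
  ... | no ¬h | no ¬h′ = contradiction (inj₁ refl)
    (C-avoids (λ l → l ≡ i ⊎ l ≡ j)
      (λ { _ q (inj₁ refl) → inj₂ (inj₂ (⋖-uniqueʳ q i⋖j))
         ; p _ (inj₂ refl) → inj₁ (inj₁ (⋖-uniqueˡ p i⋖j)) })
      (λ { h (inj₁ refl) → ¬h h ; h (inj₂ refl) → ¬h′ h }) (full (zero , i)))

Unmixed : CellSet 2 m → Set
Unmixed S = ∀ {r s i j} → i ≡ j ⊎ i ⋖ j → (r , i) ∈ S → (s , j) ∈ S → r ≡ s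

module _ {S : CellSet 2 m} (unmixed : Unmixed S) where

  -- The result of one round of rule (d). A gap filled in this round is flanked by two cells of `S`
  -- in its own row.
  Filled : Pred (Cell 2 m) 0ℓ
  Filled (r , j) = (r , j) ∈ S ⊎ ∃₂ λ i l → i ⋖ j × j ⋖ l × (r , i) ∈ S × (r , l) ∈ S

  -- If the cell in column `i` is a filled gap, its right flank is the wanted cell of `S`. Otherwise
  -- it lies in `S`, and the other cell or its left flank does too, so unmixedness forces equal
  -- rows. Corner rules involve different rows, which leaves only the first alternative.
  filled-right : ∀ {r s i j} → i ⋖ j → Filled (r , i) → Filled (s , j) → (r , j) ∈ S ⊎ r ≡ s
  filled-right {r} i⋖j (inj₂ (_ , l , _ , i⋖l , _ , p)) _ with ⋖-uniqueʳ i⋖l i⋖j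
  ... | refl = inj₁ p
  filled-right i⋖j (inj₁ p) (inj₁ q) = inj₂ (unmixed (inj₂ i⋖j) p q)
  filled-right i⋖j (inj₁ p) (inj₂ (_ , _ , h⋖j , _ , q , _)) with ⋖-uniqueˡ h⋖j i⋖j
  ... | refl = inj₂ (unmixed (inj₁ refl) p q)

  filled-left : ∀ {r s j l} → j ⋖ l → Filled (s , j) → Filled (r , l) → (r , j) ∈ S ⊎ r ≡ s
  filled-left j⋖l _ (inj₂ (i , _ , i⋖l , _ , p , _)) with ⋖-uniqueˡ i⋖l j⋖l
  ... | refl = inj₁ p
  filled-left j⋖l (inj₁ q) (inj₁ p) = inj₂ (sym (unmixed (inj₂ j⋖l) q p))
  filled-left j⋖l (inj₂ (_ , _ , _ , j⋖h , _ , q)) (inj₁ p) with ⋖-uniqueʳ j⋖h j⋖l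
  ... | refl = inj₂ (unmixed (inj₁ refl) p q)

  filled-between : ∀ {r i j l} → i ⋖ j → j ⋖ l → Filled (r , i) → Filled (r , l) → Filled (r , j)
  filled-between i⋖j j⋖l (inj₁ p) (inj₁ q) = inj₂ (_ , _ , i⋖j , j⋖l , p , q)
  filled-between i⋖j j⋖l (inj₂ (_ , _ , _ , i⋖j′ , _ , p)) _ with ⋖-uniqueʳ i⋖j′ i⋖j
  ... | refl = inj₁ p
  filled-between i⋖j j⋖l (inj₁ _) (inj₂ (_ , _ , j′⋖l , _ , p , _)) with ⋖-uniqueˡ j′⋖l j⋖l
  ... | refl = inj₁ p

  filled-closed : ∀ {u v w} → Rule u v w → Filled v → Filled w → Filled u
  filled-closed (rule-a p q _ _) = contradiction q (no-middle p)
  filled-closed (rule-b p q _ _) = contradiction q (no-middle p)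
  filled-closed (rule-c p q)     = contradiction q (no-middle p)
  filled-closed (rule-d i⋖j j⋖l) = filled-between i⋖j j⋖l
  filled-closed (rule-e p q) v w = [ inj₁ , (λ { refl → contradiction p ⋖-irrefl }) ]′ (filled-right q v w)
  filled-closed (rule-f p q) v w = [ inj₁ , (λ { refl → contradiction p ⋖-irrefl }) ]′ (filled-right q v w)
  filled-closed (rule-g p q) v w = [ inj₁ , (λ { refl → contradiction p ⋖-irrefl }) ]′ (filled-left q v w)
  filled-closed (rule-h p q) v w = [ inj₁ , (λ { refl → contradiction p ⋖-irrefl }) ]′ (filled-left q v w)

  C⇒filled : ∀ {u} → C S u → Filled u
  C⇒filled (seed u∈S)     = inj₁ u∈S
  C⇒filled (spread r p q) = filled-closed r (C⇒filled p) (C⇒filled q)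

-- The first column has no left neighbour, so rule (d) adds nothing there: both of its cells would
-- lie in `S`, in different rows of one column.
contaminating⇒mixed : {S : CellSet 2 (suc m)} → Contaminating S → ¬ Unmixed S
contaminating⇒mixed {S = S} full unmixed
  with C⇒filled unmixed (full (zero , zero)) | C⇒filled unmixed (full (suc zero , zero))
... | inj₁ p | inj₁ q with () ← unmixed {zero} {suc zero} (inj₁ refl) p q
... | inj₂ (_ , _ , () , _) | _
... | inj₁ _ | inj₂ (_ , _ , () , _)

-- Completeness of the list

hit-head : (c : Subset 2) (S : CellSet 2 m) → Hit (c ◁ S) zero → Nonempty c
hit-head c S (r , r∈) = r , head⁻ c S r∈

hit-tail : (c : Subset 2) (S : CellSet 2 m) {j : Fin m} → Hit (c ◁ S) (suc j) → Hit S j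
hit-tail c S (r , r∈) = r , tail⁻ c S r∈

covering-tail : (c : Subset 2) (S : CellSet 2 m) → Covering (c ◁ S) → Covering S
covering-tail c S cov = record
  { adjacent = λ p → [ inj₁ ∘ hit-tail c S , inj₂ ∘ hit-tail c S ]′ (adjacent cov (cong suc p))
  ; last     = hit-tail c S ∘ last cov ∘ cong suc
  }

covering-tail₂ : (c d : Subset 2) (S : CellSet 2 m) → Covering (c ◁ d ◁ S) → Covering S
covering-tail₂ c d S = covering-tail d S ∘ covering-tail c (d ◁ S)

covering-pair : (c d : Subset 2) (S : CellSet 2 m) → Covering (c ◁ d ◁ S) → Nonempty c ⊎ Nonempty d
covering-pair c d S cov with adjacent cov {zero} {suc zero} refl
... | inj₁ h = inj₁ (hit-head c _ h)
... | inj₂ h = inj₂ (hit-head d S (hit-tail c _ h))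

covering-after : (c d : Subset 2) (S : CellSet 2 (suc m)) → Covering (c ◁ d ◁ S) → ¬ Nonempty d → Hit S zero
covering-after c d S cov d-empty with adjacent cov {suc zero} {suc (suc zero)} refl
... | inj₁ h = contradiction (hit-head d S (hit-tail c _ h)) d-empty
... | inj₂ h = hit-tail d S (hit-tail c _ h)

covering-last : (c d : Subset 2) (S : CellSet 2 0) → Covering (c ◁ d ◁ S) → Nonempty d
covering-last c d S cov = hit-head d S (hit-tail c (d ◁ S) (last cov {suc zero} refl))

-- Each of the `k` blocks contains a cell.
covering⇒∣∣≥ : ∀ k (S : CellSet 2 (k * 2)) → Covering S → k ≤ ∣ S ∣
covering⇒∣∣≥ zero    S cov = z≤n
covering⇒∣∣≥ (suc k) S cov with uncons S
... | c , S₁ , refl with uncons S₁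
...   | d , S′ , refl rewrite ∣◁◁∣ c d S′ with covering-pair c d S′ cov
...     | inj₁ ne = +-mono-≤ (nonempty⇒∣∣≥1 c ne)
            (≤-trans (covering⇒∣∣≥ k S′ (covering-tail₂ c d S′ cov)) (m≤n+m ∣ S′ ∣ Sub.∣ d ∣))
...     | inj₂ ne = ≤-trans
            (+-mono-≤ (nonempty⇒∣∣≥1 d ne) (covering⇒∣∣≥ k S′ (covering-tail₂ c d S′ cov)))
            (m≤n+m (Sub.∣ d ∣ + ∣ S′ ∣) Sub.∣ c ∣)

-- Either the first block has both columns hit, which gives the extra cell, or its second column is
-- empty, the next block again starts with a hit column, and the argument repeats. It stops at the
-- last block at the latest, since the last column is hit.
covering⇒∣∣> : ∀ k (S : CellSet 2 (suc k * 2)) → Covering S → Hit S zero → suc k < ∣ S ∣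
covering⇒∣∣> k S cov h with uncons S
... | c , S₁ , refl with uncons S₁
...   | d , S′ , refl rewrite ∣◁◁∣ c d S′ with Subₚ.nonempty? d
...     | yes ne = +-mono-≤ (nonempty⇒∣∣≥1 c (hit-head c _ h))
            (+-mono-≤ (nonempty⇒∣∣≥1 d ne) (covering⇒∣∣≥ k S′ (covering-tail₂ c d S′ cov)))
covering⇒∣∣> zero S cov h | c , S₁ , refl | d , S′ , refl | no ¬ne =
  contradiction (covering-last c d S′ cov) ¬ne
covering⇒∣∣> (suc k) S cov h | c , S₁ , refl | d , S′ , refl | no ¬ne =
  +-mono-≤ (nonempty⇒∣∣≥1 c (hit-head c _ h))
    (≤-trans (covering⇒∣∣> k S′ (covering-tail₂ c d S′ cov) (covering-after c d S′ cov ¬ne)) (m≤n+m ∣ S′ ∣ Sub.∣ d ∣))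

alternating-complete : ∀ k (S : CellSet 2 (k * 2)) → Covering S → ∣ S ∣ ≡ k → S ∈ˡ alternating k
alternating-complete zero    ([] ∷ [] ∷ []) cov eq = here refl
alternating-complete (suc k) S cov eq with uncons S
... | c , S₁ , refl with uncons S₁
...   | d , S′ , refl with Subₚ.nonempty? c
-- A hit first column would cost one cell too many.
...     | yes (r , r∈c) = contradiction (sym eq) (<⇒≢ (covering⇒∣∣> k S cov (r , head⁺ c _ r∈c)))
...     | no ¬ne with Subₚ.Empty-unique ¬ne
...       | refl with covering-pair c d S′ cov
...         | inj₁ ne = contradiction ne ¬ne
...         | inj₂ ne with +-tight (nonempty⇒∣∣≥1 d ne)
                             (covering⇒∣∣≥ k S′ (covering-tail₂ c d S′ cov)) (trans (sym (∣◁◁∣ c d S′)) eq)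
...           | ∣d∣≡1 , ∣S′∣≡k with ∣∣≡1⇒singleton d ∣d∣≡1
...             | r , refl = ∈-alternating⁺ k r
                    (alternating-complete k S′ (covering-tail₂ c d S′ cov) ∣S′∣≡k)

unmixed-◁ : (c : Subset 2) (S : CellSet 2 m) → (∀ {r s} → r Sub.∈ c → s Sub.∈ c → r ≡ s) →
            (∀ {r s j} → toℕ j ≡ 0 → r Sub.∈ c → (s , j) ∈ S → r ≡ s) → Unmixed S → Unmixed (c ◁ S)
unmixed-◁ c S col next un {i = zero}  {zero}  _ p q = col (head⁻ c S p) (head⁻ c S q)
unmixed-◁ c S col next un {i = zero}  {suc j} (inj₂ eq) p q =
  next (sym (suc-injective eq)) (head⁻ c S p) (tail⁻ c S q)
unmixed-◁ c S col next un {i = suc i} {zero}  (inj₁ ())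
unmixed-◁ c S col next un {i = suc i} {zero}  (inj₂ ())
unmixed-◁ c S col next un {i = suc i} {suc j} (inj₁ refl) p q = un (inj₁ refl) (tail⁻ c S p) (tail⁻ c S q)
unmixed-◁ c S col next un {i = suc i} {suc j} (inj₂ eq) p q =
  un (inj₂ (suc-injective eq)) (tail⁻ c S p) (tail⁻ c S q)

⁅⁆-single : (t : Fin 2) {r s : Fin 2} → r Sub.∈ ⁅ t ⁆ → s Sub.∈ ⁅ t ⁆ → r ≡ s
⁅⁆-single t p q = trans (Subₚ.x∈⁅y⁆⇒x≡y t p) (sym (Subₚ.x∈⁅y⁆⇒x≡y t q))

unmixed-⊥◁ : (S : CellSet 2 m) → Unmixed S → Unmixed (⊥ ◁ S)
unmixed-⊥◁ S = unmixed-◁ ⊥ S (λ r∈ _ → contradiction r∈ Subₚ.∉⊥) (λ _ r∈ _ → contradiction r∈ Subₚ.∉⊥)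

unmixed-⁅⁆◁⊥◁ : (t : Fin 2) (S : CellSet 2 m) → Unmixed S → Unmixed (⁅ t ⁆ ◁ ⊥ ◁ S)
unmixed-⁅⁆◁⊥◁ t S un = unmixed-◁ ⁅ t ⁆ (⊥ ◁ S) (⁅⁆-single t)
  (λ { {j = zero} _ _ q → contradiction (head⁻ ⊥ S q) Subₚ.∉⊥ }) (unmixed-⊥◁ S un)

alternating-first : ∀ k {S} → S ∈ˡ alternating k → ∀ {r j} → toℕ j ≡ 0 → ¬ (r , j) ∈ S
alternating-first (suc k) S∈ {j = zero} _ p with ∈-alternating⁻ k S∈
... | s , S′ , _ , refl = Subₚ.∉⊥ (head⁻ ⊥ (⁅ s ⁆ ◁ S′) p)

unmixed-⁅⁆◁alternating : ∀ k (t : Fin 2) {S} → S ∈ˡ alternating k → Unmixed S → Unmixed (⁅ t ⁆ ◁ S)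
unmixed-⁅⁆◁alternating k t {S} S∈ = unmixed-◁ ⁅ t ⁆ S (⁅⁆-single t)
  (λ j≡0 _ q → contradiction q (alternating-first k S∈ j≡0))

alternating-unmixed : ∀ k {S} → S ∈ˡ alternating k → Unmixed S
alternating-unmixed zero    _ {i = ()}
alternating-unmixed (suc k) S∈ with ∈-alternating⁻ k S∈
... | s , S′ , S′∈ , refl =
  unmixed-⊥◁ (⁅ s ⁆ ◁ S′) (unmixed-⁅⁆◁alternating k s S′∈ (alternating-unmixed k S′∈))

unmixed-⁅⁆◁⁅⁆◁alternating : ∀ k (t : Fin 2) {S} → S ∈ˡ alternating k → Unmixed (⁅ t ⁆ ◁ ⁅ t ⁆ ◁ S)
unmixed-⁅⁆◁⁅⁆◁alternating k t {S} S∈ = unmixed-◁ ⁅ t ⁆ (⁅ t ⁆ ◁ S) (⁅⁆-single t)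
  (λ { {j = zero} _ p q → ⁅⁆-single t p (head⁻ ⁅ t ⁆ S q) })
  (unmixed-⁅⁆◁alternating k t S∈ (alternating-unmixed k S∈))

-- If the second column is hit, the count makes both columns singletons and the suffix alternating;
-- equal rows would leave the word unmixed. If it is empty, the suffix starts with a hit column and
-- has the least possible size, and the mixing must occur inside it.
optima-complete : ∀ k (S : CellSet 2 (suc k * 2)) → Covering S → Hit S zero → ¬ Unmixed S →
                  ∣ S ∣ ≡ suc (suc k) → S ∈ˡ optima (suc k)
optima-complete k S cov h mixed eq with uncons S
... | c , S₁ , refl with uncons S₁
...   | d , S′ , refl with Subₚ.nonempty? d
...     | yes ne with +-tight (nonempty⇒∣∣≥1 c (hit-head c (d ◁ S′) h))
                        (+-mono-≤ (nonempty⇒∣∣≥1 d ne) (covering⇒∣∣≥ k S′ (covering-tail₂ c d S′ cov)))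
                        (trans (sym (∣◁◁∣ c d S′)) eq)
...       | ∣c∣≡1 , eq′ with +-tight (nonempty⇒∣∣≥1 d ne)
                               (covering⇒∣∣≥ k S′ (covering-tail₂ c d S′ cov)) eq′
...         | ∣d∣≡1 , ∣S′∣≡k with ∣∣≡1⇒singleton c ∣c∣≡1 | ∣∣≡1⇒singleton d ∣d∣≡1
                                | alternating-complete k S′ (covering-tail₂ c d S′ cov) ∣S′∣≡k
...           | r , refl | s , refl | S′∈ with r ≟ᶠ s
...             | yes refl = ⊥-elim (mixed (unmixed-⁅⁆◁⁅⁆◁alternating k r S′∈))
...             | no r≢s with ≢⇒opposite r≢s
...               | refl = ∈-optima⁺ (pair {k} r {S′} S′∈)
optima-complete zero S cov h mixed eq | c , S₁ , refl | d , S′ , refl | no ¬ne =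
  contradiction (covering-last c d S′ cov) ¬ne
optima-complete (suc k) S cov h mixed eq | c , S₁ , refl | d , S′ , refl | no ¬ne
  with Subₚ.Empty-unique ¬ne
-- With `d` replaced by `⊥`, its contribution to the sum computes to 0.
... | refl with +-tight (nonempty⇒∣∣≥1 c (hit-head c (d ◁ S′) h))
                  (covering⇒∣∣> k S′ (covering-tail₂ c d S′ cov) (covering-after c d S′ cov ¬ne))
                  (trans (sym (∣◁◁∣ c d S′)) eq)
...   | ∣c∣≡1 , ∣S′∣≡ with ∣∣≡1⇒singleton c ∣c∣≡1
...     | r , refl = ∈-optima⁺ (skip {suc k} r {S′} (optima-complete k S′ (covering-tail₂ c d S′ cov)
            (covering-after c d S′ cov ¬ne) (λ un → mixed (unmixed-⁅⁆◁⊥◁ r S′ un)) ∣S′∣≡))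

-- The contamination number and the count

alternating-inhabited : ∀ k → ∃[ S ] S ∈ˡ alternating k
alternating-inhabited zero    = _ , here refl
alternating-inhabited (suc k) = _ , ∈-alternating⁺ k zero (proj₂ (alternating-inhabited k))

-- The bound `v ≤ n * m` handles the default value in the minimum that defines `γ-c`.
γ-c≡ : ∀ {n m v} (S : CellSet n m) → Contaminating S → ∣ S ∣ ≡ v → v ≤ n * m →
       (∀ (T : CellSet n m) → Contaminating T → v ≤ ∣ T ∣) → γ-c n m ≡ v
γ-c≡ {n} {m} {v} S full eq v≤nm v≤ = ≤-antisym
  (min≤v⁺ (n * m) sizes (inj₂ (lose (∈-map⁺ ∣_∣ (∈-filter⁺ contaminating? (∈-cellSets S) full)) (≤-reflexive eq))))
  (v≤min⁺ {xs = sizes} v≤nm (All.tabulate bound))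
  where
  sizes : List ℕ
  sizes = map ∣_∣ (filter contaminating? (cellSets n m))

  bound : ∀ {x} → x ∈ˡ sizes → v ≤ x
  bound x∈ with ∈-map⁻ ∣_∣ x∈
  ... | T , T∈ , refl = v≤ T (proj₂ (∈-filter⁻ contaminating? {xs = cellSets n m} T∈))

-- Lists without repetitions and with the same members are permutations of each other.
length-filter-complete : {A : Set} {P : Pred A 0ℓ} (P? : Decidable P) {xs ys : List A} →
                         Unique xs → (∀ x → x ∈ˡ xs) → Unique ys →
                         (∀ {x} → P x → x ∈ˡ ys) → (∀ {x} → x ∈ˡ ys → P x) →
                         length (filter P? xs) ≡ length ys
length-filter-complete P? {xs} xs! all ys! P⇒∈ ∈⇒P = ↭-length (∼bag⇒↭ (unique∧set⇒bag (filter⁺ P? xs!) ys!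
  (mk⇔ (λ x∈ → P⇒∈ (proj₂ (∈-filter⁻ P? {xs = xs} x∈))) (λ x∈ → ∈-filter⁺ P? (all _) (∈⇒P x∈)))))

α≡length : ∀ m {xs : List (CellSet 2 m)} → Unique xs →
           (∀ {S} → Optimal S → S ∈ˡ xs) → (∀ {S} → S ∈ˡ xs → Optimal S) → α 2 m ≡ length xs
α≡length m = length-filter-complete (optimal? {2} {m}) (cellSets-unique 2 m) ∈-cellSets

γ-c-even : ∀ k → γ-c 2 (suc k * 2) ≡ suc (suc k)
γ-c-even k = γ-c≡ (diagonal zero S) (optima-contaminating (suc k) S∈) (∣optima∣ (suc k) S∈)
  -- The default value is `2 * (suc k * 2)`, which unfolds to 2 plus a sum starting with `k * 2`.
  (s≤s (s≤s (≤-trans (m≤m*n k 2) (m≤m+n (k * 2) _))))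
  (λ T full → covering⇒∣∣> k T (contaminating⇒covering full) (contaminating⇒first full))
  where
  S : CellSet 2 (k * 2)
  S = proj₁ (alternating-inhabited k)

  S∈ : diagonal zero S ∈ˡ optima (suc k)
  S∈ = ∈-optima⁺ (pair {k} zero (proj₂ (alternating-inhabited k)))

optimal⇒∈optima : ∀ k {S} → Optimal S → S ∈ˡ optima (suc k)
optimal⇒∈optima k {S} (full , eq) = optima-complete k S (contaminating⇒covering full)
  (contaminating⇒first full) (contaminating⇒mixed full) (trans eq (γ-c-even k))

∈optima⇒optimal : ∀ k {S} → S ∈ˡ optima (suc k) → Optimal S
∈optima⇒optimal k S∈ =
  optima-contaminating (suc k) S∈ , trans (∣optima∣ (suc k) S∈) (sym (γ-c-even k))

proposition6 : (k : ℕ) → 1 ≤ k → α 2 (2 * k) ≡ k * 2 ^ k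
proposition6 (suc k) _ = begin
  α 2 (2 * suc k)          ≡⟨ cong (α 2) (*-comm 2 (suc k)) ⟩
  α 2 (suc k * 2)          ≡⟨ α≡length (suc k * 2) (optima-unique (suc k)) (optimal⇒∈optima k) (∈optima⇒optimal k) ⟩
  length (optima (suc k))  ≡⟨ length-optima (suc k) ⟩
  suc k * 2 ^ suc k        ∎
  where open ≡-Reasoning
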